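{- Let $m\geq 1$ and $\mathfrak{a}_{1},\ldots,\mathfrak{a}_m\in GL_l(\mathbb{C})$ be such that $\mathfrak{Q}_m$ is invertible, with inverse $\mathfrak{R}_m$. Then $\mathfrak{P}_m:=(-1)^{m-1}\left((\mathfrak{R}_{m})_{m1}\right)^{ -1}$ satisfies $$\mathfrak{P}_{m}=\mathfrak{p}_{m}(\mathfrak{a}_{1},\ldots,\mathfrak{a}_{m}),$$ where $(\mathfrak{R}_{m})_{m1}$ is the $l\times l$ block of $\mathfrak{R}_m$ in block position $(m,1)$.
   Context: $I$, $O$ are the $l\times l$ identity and zero matrices. The left matrix signed Chebyshev polynomials are defined by $\mathfrak{p}_{ -1}=O$, $\mathfrak{p}_{0}=I$ and $$\mathfrak{p}_{m}(\mathfrak{a}_{1},\ldots,\mathfrak{a}_{m})=\mathfrak{a}_{m}\mathfrak{p}_{m-1}(\mathfrak{a}_{1},\ldots,\mathfrak{a}_{m-1})-\mathfrak{p}_{m-2}(\mathfrak{a}_{1},\ldots,\mathfrak{a}_{m-2}),\quad m\ge 1.$$ $\mathfrak{Q}_1=\mathfrak{a}_1$ and, for $m\ge 2$, $\mathfrak{Q}_m$ is the block tridiagonal $ml\times ml$ matrix, with $m\times m$ blocks of size $l\times l$, with diagonal blocks $\mathfrak{a}_{m},\mathfrak{a}_{m-1},\ldots,\mathfrak{a}_1$ (from top left to bottom right), all blocks immediately above and immediately below the diagonal equal to $I$, and all other blocks equal to $O$. -}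

module Defs where

open import Level using (Level; 0ℓ; _⊔_)
open import Algebra.Bundles using (CommutativeRing; Semiring)
open import Algebra.Structures using (IsCommutativeRing)
open import Data.Fin.Base as Fin
  using (Fin; zero; suc; fromℕ; opposite; combine; quotient; remainder; toℕ)
import Data.Fin.Properties as Fin
open import Data.Nat.Base as ℕ using (ℕ; zero; suc)
import Data.Nat.Properties as ℕ
open import Data.Product.Base using (∃; _×_; _,_; proj₁; proj₂)
open import Data.Rational.Base as ℚ using (ℚ; 0ℚ; 1ℚ; ½; positive)
import Data.Rational.Properties as ℚ
open import Data.Rational.Solver using (module +-*-Solver)
open import Data.Vec.Functional using (Vector; init; last)
open import Relation.Binary.PropositionalEquality
  using (_≡_; refl; sym; trans; cong; subst)
open import Relation.Nullary.Decidable using (yes; no)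

------------------------------------------------------------------------
-- Real numbers: Cauchy sequences of rationals, equal when their
-- difference is a null sequence.

IsCauchy : (ℕ → ℚ) → Set
IsCauchy f = ∀ (ε : ℚ) → 0ℚ ℚ.< ε →
  ∃ λ N → ∀ m n → N ℕ.≤ m → N ℕ.≤ n → ℚ.∣ f m ℚ.- f n ∣ ℚ.< ε

IsNull : (ℕ → ℚ) → Set
IsNull f = ∀ (ε : ℚ) → 0ℚ ℚ.< ε → ∃ λ N → ∀ n → N ℕ.≤ n → ℚ.∣ f n ∣ ℚ.< ε

record ℝ : Set where
  constructor mkℝ
  field
    seq    : ℕ → ℚ
    cauchy : IsCauchy seq

open ℝ public

infix 4 _≈ℝ_

record _≈ℝ_ (x y : ℝ) : Set where
  constructor mk≈ℝ
  field
    null : IsNull (λ n → seq x n ℚ.- seq y n)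

open _≈ℝ_ public

private

  open +-*-Solver

  half-sum : ∀ ε → ε ℚ.* ½ ℚ.+ ε ℚ.* ½ ≡ ε
  half-sum ε = trans (sym (ℚ.*-distribˡ-+ ε ½ ½)) (ℚ.*-identityʳ ε)

  half-pos : ∀ ε → 0ℚ ℚ.< ε → 0ℚ ℚ.< ε ℚ.* ½
  half-pos ε 0<ε = ℚ.positive⁻¹ (ε ℚ.* ½) {{ℚ.pos*pos⇒pos ε {{positive 0<ε}} ½}}

  +-estimate : ∀ p q {ε} → ℚ.∣ p ∣ ℚ.< ε ℚ.* ½ → ℚ.∣ q ∣ ℚ.< ε ℚ.* ½ →
               ℚ.∣ p ℚ.+ q ∣ ℚ.< ε
  +-estimate p q {ε} p< q< = subst (ℚ.∣ p ℚ.+ q ∣ ℚ.<_) (half-sum ε)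
    (ℚ.≤-<-trans (ℚ.∣p+q∣≤∣p∣+∣q∣ p q) (ℚ.+-mono-< p< q<))

  -- |p r| ≤ B δ
  *-bound : ∀ p r {B δ} → 0ℚ ℚ.< B → ℚ.∣ p ∣ ℚ.< B → ℚ.∣ r ∣ ℚ.< δ →
            ℚ.∣ p ℚ.* r ∣ ℚ.≤ B ℚ.* δ
  *-bound p r {B} {δ} 0<B p< r< = subst (ℚ._≤ B ℚ.* δ) (sym (ℚ.∣p*q∣≡∣p∣*∣q∣ p r))
    (ℚ.≤-trans
      (ℚ.*-monoʳ-≤-nonNeg ℚ.∣ r ∣ {{ℚ.∣-∣-nonNeg r}} (ℚ.<⇒≤ p<))
      (ℚ.*-monoˡ-≤-nonNeg B {{ℚ.nonNegative (ℚ.<⇒≤ 0<B)}} (ℚ.<⇒≤ r<)))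

  record Scaling (A B ε : ℚ) : Set where
    field
      δ        : ℚ
      0<δ      : 0ℚ ℚ.< δ
      estimate : ∀ a b c d → ℚ.∣ a ∣ ℚ.< A → ℚ.∣ d ∣ ℚ.< B →
                 ℚ.∣ b ℚ.- d ∣ ℚ.< δ → ℚ.∣ a ℚ.- c ∣ ℚ.< δ →
                 ℚ.∣ a ℚ.* b ℚ.- c ℚ.* d ∣ ℚ.< ε

  -- δ = ε / (2 (A + B))
  scaling : ∀ {A B ε} → 0ℚ ℚ.< A → 0ℚ ℚ.< B → 0ℚ ℚ.< ε → Scaling A B ε
  scaling {A} {B} {ε} 0<A 0<B 0<ε = record
    { δ = δ
    ; 0<δ = ℚ.positive⁻¹ δ
        {{ℚ.pos*pos⇒pos (ℚ.1/ C) {{ℚ.1/pos⇒pos C}}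
                        (ε ℚ.* ½) {{positive (half-pos ε 0<ε)}}}}
    ; estimate = λ a b c d a< d< bd< ac< →
        ℚ.≤-<-trans (≤½ a b c d a< d< bd< ac<) ½<
    }
    where
    C : ℚ
    C = A ℚ.+ B

    instance
      C-pos : ℚ.Positive C
      C-pos = positive (ℚ.+-mono-< 0<A 0<B)

      C-nonZero : ℚ.NonZero C
      C-nonZero = ℚ.pos⇒nonZero C

    δ : ℚ
    δ = ℚ.1/ C ℚ.* (ε ℚ.* ½)

    δ-eq : A ℚ.* δ ℚ.+ B ℚ.* δ ≡ ε ℚ.* ½
    δ-eq = trans (sym (ℚ.*-distribʳ-+ δ A B))
      (trans (sym (ℚ.*-assoc C (ℚ.1/ C) (ε ℚ.* ½)))
      (trans (cong (ℚ._* (ε ℚ.* ½)) (ℚ.*-inverseʳ C)) (ℚ.*-identityˡ (ε ℚ.* ½))))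

    ½< : ε ℚ.* ½ ℚ.< ε
    ½< = subst (ε ℚ.* ½ ℚ.<_) (half-sum ε)
      (subst (ℚ._< ε ℚ.* ½ ℚ.+ ε ℚ.* ½) (ℚ.+-identityʳ (ε ℚ.* ½))
        (ℚ.+-monoʳ-< (ε ℚ.* ½) (half-pos ε 0<ε)))

    split : ∀ a b c d →
      a ℚ.* (b ℚ.- d) ℚ.+ d ℚ.* (a ℚ.- c) ≡ a ℚ.* b ℚ.- c ℚ.* d
    split = solve 4 (λ a b c d → a :* (b :- d) :+ d :* (a :- c) := a :* b :- c :* d)
      refl

    ≤½ : ∀ a b c d → ℚ.∣ a ∣ ℚ.< A → ℚ.∣ d ∣ ℚ.< B →
         ℚ.∣ b ℚ.- d ∣ ℚ.< δ → ℚ.∣ a ℚ.- c ∣ ℚ.< δ →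
         ℚ.∣ a ℚ.* b ℚ.- c ℚ.* d ∣ ℚ.≤ ε ℚ.* ½
    ≤½ a b c d a< d< bd< ac< = subst (λ t → ℚ.∣ t ∣ ℚ.≤ ε ℚ.* ½) (split a b c d)
      (ℚ.≤-trans (ℚ.∣p+q∣≤∣p∣+∣q∣ (a ℚ.* (b ℚ.- d)) (d ℚ.* (a ℚ.- c)))
        (subst (ℚ.∣ a ℚ.* (b ℚ.- d) ∣ ℚ.+ ℚ.∣ d ℚ.* (a ℚ.- c) ∣ ℚ.≤_) δ-eq
          (ℚ.+-mono-≤ (*-bound a (b ℚ.- d) 0<A a< bd<)
                      (*-bound d (a ℚ.- c) 0<B d< ac<))))

  EventuallyBounded : (ℕ → ℚ) → Set
  EventuallyBounded f = ∃ λ B → 0ℚ ℚ.< B × ∃ λ N → ∀ n → N ℕ.≤ n → ℚ.∣ f n ∣ ℚ.< B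

  eventually-bounded : ∀ {f} → IsCauchy f → EventuallyBounded f
  eventually-bounded {f} f-cauchy with f-cauchy 1ℚ (ℚ.positive⁻¹ 1ℚ)
  ... | N , close = 1ℚ ℚ.+ ℚ.∣ f N ∣
      , ℚ.+-mono-<-≤ (ℚ.positive⁻¹ 1ℚ) (ℚ.0≤∣p∣ (f N))
      , N
      , λ n N≤n → subst (λ t → ℚ.∣ t ∣ ℚ.< 1ℚ ℚ.+ ℚ.∣ f N ∣)
          (solve 2 (λ p q → (p :- q) :+ q := p) refl (f n) (f N))
          (ℚ.≤-<-trans (ℚ.∣p+q∣≤∣p∣+∣q∣ (f n ℚ.- f N) (f N))
            (ℚ.+-monoˡ-< ℚ.∣ f N ∣ (close n N N≤n ℕ.≤-refl)))

  left : ∀ {m n o} → m ℕ.⊔ n ℕ.≤ o → m ℕ.≤ o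
  left {m} {n} = ℕ.m⊔n≤o⇒m≤o m n

  right : ∀ {m n o} → m ℕ.⊔ n ℕ.≤ o → n ℕ.≤ o
  right {m} {n} = ℕ.m⊔n≤o⇒n≤o m n

  neg-diff : ∀ p q → ℚ.∣ ℚ.- p ℚ.- ℚ.- q ∣ ≡ ℚ.∣ p ℚ.- q ∣
  neg-diff p q = trans
    (cong ℚ.∣_∣ (solve 2 (λ p q → :- p :- :- q := :- (p :- q)) refl p q))
    (ℚ.∣-p∣≡∣p∣ (p ℚ.- q))

  +-diff : ∀ p q r s → (p ℚ.- r) ℚ.+ (q ℚ.- s) ≡ (p ℚ.+ q) ℚ.- (r ℚ.+ s)
  +-diff = solve 4 (λ p q r s → (p :- r) :+ (q :- s) := (p :+ q) :- (r :+ s)) refl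

abstract

  +-cauchy : ∀ {f g} → IsCauchy f → IsCauchy g → IsCauchy (λ n → f n ℚ.+ g n)
  +-cauchy {f} {g} cf cg ε 0<ε
    with cf (ε ℚ.* ½) (half-pos ε 0<ε) | cg (ε ℚ.* ½) (half-pos ε 0<ε)
  ... | M , f-close | N , g-close = M ℕ.⊔ N , λ m n m≥ n≥ →
    subst (λ t → ℚ.∣ t ∣ ℚ.< ε) (+-diff (f m) (g m) (f n) (g n))
      (+-estimate (f m ℚ.- f n) (g m ℚ.- g n)
        (f-close m n (left m≥) (left n≥)) (g-close m n (right m≥) (right n≥)))

  neg-cauchy : ∀ {f} → IsCauchy f → IsCauchy (λ n → ℚ.- f n)
  neg-cauchy {f} cf ε 0<ε with cf ε 0<ε
  ... | N , f-close = N , λ m n m≥ n≥ →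
    subst (ℚ._< ε) (sym (neg-diff (f m) (f n))) (f-close m n m≥ n≥)

  *-cauchy′ : ∀ {f g} → EventuallyBounded f → EventuallyBounded g →
              IsCauchy f → IsCauchy g → IsCauchy (λ n → f n ℚ.* g n)
  *-cauchy′ {f} {g} (A , 0<A , K , f<) (B , 0<B , L , g<) cf cg ε 0<ε =
    close (scaling {A} {B} {ε} 0<A 0<B 0<ε)
    where
    close : Scaling A B ε → ∃ λ N → ∀ m n → N ℕ.≤ m → N ℕ.≤ n →
            ℚ.∣ f m ℚ.* g m ℚ.- f n ℚ.* g n ∣ ℚ.< ε
    close S = N , λ m n m≥ n≥ →
      estimate (f m) (g m) (f n) (g n)
        (f< m (left {K} {L} (left {K ℕ.⊔ L} {M} m≥)))
        (g< n (right {K} {L} (left {K ℕ.⊔ L} {M} n≥)))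
        (proj₂ (cg δ 0<δ) m n (right {M₁} {M₂} (right {K ℕ.⊔ L} {M} m≥))
                       (right {M₁} {M₂} (right {K ℕ.⊔ L} {M} n≥)))
        (proj₂ (cf δ 0<δ) m n (left {M₁} {M₂} (right {K ℕ.⊔ L} {M} m≥))
                       (left {M₁} {M₂} (right {K ℕ.⊔ L} {M} n≥)))
      where
      open Scaling S
      M₁ M₂ M N : ℕ
      M₁ = proj₁ (cf δ 0<δ)
      M₂ = proj₁ (cg δ 0<δ)
      M  = M₁ ℕ.⊔ M₂
      N  = (K ℕ.⊔ L) ℕ.⊔ M

  *-cauchy : ∀ {f g} → IsCauchy f → IsCauchy g → IsCauchy (λ n → f n ℚ.* g n)
  *-cauchy {f} {g} cf cg = *-cauchy′ {f} {g}
    (eventually-bounded {f} cf) (eventually-bounded {g} cg) cf cg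

  const-cauchy : ∀ q → IsCauchy (λ _ → q)
  const-cauchy q ε 0<ε = 0 , λ _ _ _ _ →
    subst (λ t → ℚ.∣ t ∣ ℚ.< ε) (sym (ℚ.+-inverseʳ q)) 0<ε

infixl 7 _*ℝ_
infixl 6 _+ℝ_
infix  8 -ℝ_

fromℚ : ℚ → ℝ
fromℚ q = mkℝ (λ _ → q) (const-cauchy q)

0ℝ 1ℝ : ℝ
0ℝ = fromℚ 0ℚ
1ℝ = fromℚ 1ℚ

_+ℝ_ _*ℝ_ : ℝ → ℝ → ℝ
x +ℝ y = mkℝ (λ n → seq x n ℚ.+ seq y n) (+-cauchy {seq x} {seq y} (cauchy x) (cauchy y))
x *ℝ y = mkℝ (λ n → seq x n ℚ.* seq y n) (*-cauchy {seq x} {seq y} (cauchy x) (cauchy y))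

-ℝ_ : ℝ → ℝ
-ℝ x = mkℝ (λ n → ℚ.- seq x n) (neg-cauchy {seq x} (cauchy x))

private

  open +-*-Solver

  pointwise : ∀ {x y} → (∀ n → seq x n ≡ seq y n) → x ≈ℝ y
  pointwise {x} {y} eq = mk≈ℝ λ ε 0<ε → 0 , λ n _ →
    subst (λ t → ℚ.∣ t ∣ ℚ.< ε)
      (sym (trans (cong (ℚ._- seq y n) (eq n)) (ℚ.+-inverseʳ (seq y n)))) 0<ε

  ≈ℝ-refl : ∀ {x} → x ≈ℝ x
  ≈ℝ-refl = pointwise λ _ → refl

  ≈ℝ-sym : ∀ {x y} → x ≈ℝ y → y ≈ℝ x
  ≈ℝ-sym {x} {y} (mk≈ℝ x≈y) = mk≈ℝ λ ε 0<ε → proj₁ (x≈y ε 0<ε) , λ n n≥ →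
    subst (ℚ._< ε)
      (trans (sym (ℚ.∣-p∣≡∣p∣ (seq x n ℚ.- seq y n)))
        (cong ℚ.∣_∣ (solve 2 (λ p q → :- (p :- q) := q :- p) refl (seq x n) (seq y n))))
      (proj₂ (x≈y ε 0<ε) n n≥)

  +-null : ∀ (f g : ℕ → ℚ) → IsNull f → IsNull g → IsNull (λ n → f n ℚ.+ g n)
  +-null f g nf ng ε 0<ε
    with nf (ε ℚ.* ½) (half-pos ε 0<ε) | ng (ε ℚ.* ½) (half-pos ε 0<ε)
  ... | M , f< | N , g< = M ℕ.⊔ N , λ n n≥ →
    +-estimate (f n) (g n) (f< n (left n≥)) (g< n (right {M} n≥))

  null-resp : ∀ (f g : ℕ → ℚ) → (∀ n → f n ≡ g n) → IsNull f → IsNull g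
  null-resp f g eq nf ε 0<ε = proj₁ (nf ε 0<ε) , λ n n≥ →
    subst (λ t → ℚ.∣ t ∣ ℚ.< ε) (eq n) (proj₂ (nf ε 0<ε) n n≥)

  diff : ℝ → ℝ → ℕ → ℚ
  diff x y n = seq x n ℚ.- seq y n

  ≈ℝ-trans : ∀ {x y z} → x ≈ℝ y → y ≈ℝ z → x ≈ℝ z
  ≈ℝ-trans {x} {y} {z} (mk≈ℝ x≈y) (mk≈ℝ y≈z) = mk≈ℝ
    (null-resp (λ n → diff x y n ℚ.+ diff y z n) (diff x z)
      (λ n → solve 3 (λ p q r → (p :- q) :+ (q :- r) := p :- r) refl
        (seq x n) (seq y n) (seq z n))
      (+-null (diff x y) (diff y z) x≈y y≈z))

  +ℝ-cong : ∀ {x y u v} → x ≈ℝ y → u ≈ℝ v → x +ℝ u ≈ℝ y +ℝ v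
  +ℝ-cong {x} {y} {u} {v} (mk≈ℝ x≈y) (mk≈ℝ u≈v) = mk≈ℝ
    (null-resp (λ n → diff x y n ℚ.+ diff u v n) (diff (x +ℝ u) (y +ℝ v))
      (λ n → +-diff (seq x n) (seq u n) (seq y n) (seq v n))
      (+-null (diff x y) (diff u v) x≈y u≈v))

  -ℝ-cong : ∀ {x y} → x ≈ℝ y → -ℝ x ≈ℝ -ℝ y
  -ℝ-cong {x} {y} (mk≈ℝ x≈y) = mk≈ℝ λ ε 0<ε → proj₁ (x≈y ε 0<ε) , λ n n≥ →
    subst (ℚ._< ε) (sym (neg-diff (seq x n) (seq y n))) (proj₂ (x≈y ε 0<ε) n n≥)

  *-null : ∀ (f g h k : ℕ → ℚ) → EventuallyBounded f → EventuallyBounded k →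
           IsNull (λ n → f n ℚ.- g n) → IsNull (λ n → h n ℚ.- k n) →
           IsNull (λ n → f n ℚ.* h n ℚ.- g n ℚ.* k n)
  *-null f g h k (A , 0<A , K , f<) (B , 0<B , L , k<) fg hk ε 0<ε =
    small (scaling {A} {B} {ε} 0<A 0<B 0<ε)
    where
    small : Scaling A B ε → ∃ λ N → ∀ n → N ℕ.≤ n →
            ℚ.∣ f n ℚ.* h n ℚ.- g n ℚ.* k n ∣ ℚ.< ε
    small S = N , λ n n≥ →
      estimate (f n) (h n) (g n) (k n)
        (f< n (left {K} {L} (left {K ℕ.⊔ L} {M} n≥)))
        (k< n (right {K} {L} (left {K ℕ.⊔ L} {M} n≥)))
        (proj₂ (hk δ 0<δ) n (right {M₁} {M₂} (right {K ℕ.⊔ L} {M} n≥)))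
        (proj₂ (fg δ 0<δ) n (left {M₁} {M₂} (right {K ℕ.⊔ L} {M} n≥)))
      where
      open Scaling S
      M₁ M₂ M N : ℕ
      M₁ = proj₁ (fg δ 0<δ)
      M₂ = proj₁ (hk δ 0<δ)
      M  = M₁ ℕ.⊔ M₂
      N  = (K ℕ.⊔ L) ℕ.⊔ M

  *ℝ-cong : ∀ {x y u v} → x ≈ℝ y → u ≈ℝ v → x *ℝ u ≈ℝ y *ℝ v
  *ℝ-cong {x} {y} {u} {v} (mk≈ℝ x≈y) (mk≈ℝ u≈v) = mk≈ℝ
    (*-null (seq x) (seq y) (seq u) (seq v)
      (eventually-bounded {seq x} (cauchy x)) (eventually-bounded {seq v} (cauchy v))
      x≈y u≈v)

infix  4 _≈ℂ_
infixl 7 _*ℂ_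
infixl 6 _+ℂ_
infix  8 -ℂ_

record ℂ : Set where
  constructor _+i_
  field
    re im : ℝ

open ℂ public

record _≈ℂ_ (z w : ℂ) : Set where
  constructor mk≈ℂ
  field
    re≈ : re z ≈ℝ re w
    im≈ : im z ≈ℝ im w

open _≈ℂ_ public

0ℂ 1ℂ : ℂ
0ℂ = 0ℝ +i 0ℝ
1ℂ = 1ℝ +i 0ℝ

_+ℂ_ _*ℂ_ : ℂ → ℂ → ℂ
z +ℂ w = (re z +ℝ re w) +i (im z +ℝ im w)
z *ℂ w = (re z *ℝ re w +ℝ -ℝ (im z *ℝ im w)) +i (re z *ℝ im w +ℝ im z *ℝ re w)

-ℂ_ : ℂ → ℂ
-ℂ z = (-ℝ re z) +i (-ℝ im z)

private

  open +-*-Solver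

  pointwiseℂ : ∀ {z w} → (∀ n → seq (re z) n ≡ seq (re w) n) →
               (∀ n → seq (im z) n ≡ seq (im w) n) → z ≈ℂ w
  pointwiseℂ p q = mk≈ℂ (pointwise p) (pointwise q)

  *ℂ-comm : ∀ z w → z *ℂ w ≈ℂ w *ℂ z
  *ℂ-comm z w = pointwiseℂ
    (λ n → solve 4 (λ a b c d → a :* c :- b :* d := c :* a :- d :* b) refl
      (seq (re z) n) (seq (im z) n) (seq (re w) n) (seq (im w) n))
    (λ n → solve 4 (λ a b c d → a :* d :+ b :* c := c :* b :+ d :* a) refl
      (seq (re z) n) (seq (im z) n) (seq (re w) n) (seq (im w) n))

  *ℂ-assoc : ∀ z w v → (z *ℂ w) *ℂ v ≈ℂ z *ℂ (w *ℂ v)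
  *ℂ-assoc z w v = pointwiseℂ
    (λ n → solve 6 (λ a b c d e f →
        (a :* c :- b :* d) :* e :- (a :* d :+ b :* c) :* f :=
        a :* (c :* e :- d :* f) :- b :* (c :* f :+ d :* e)) refl
      (seq (re z) n) (seq (im z) n) (seq (re w) n) (seq (im w) n)
      (seq (re v) n) (seq (im v) n))
    (λ n → solve 6 (λ a b c d e f →
        (a :* c :- b :* d) :* f :+ (a :* d :+ b :* c) :* e :=
        a :* (c :* f :+ d :* e) :+ b :* (c :* e :- d :* f)) refl
      (seq (re z) n) (seq (im z) n) (seq (re w) n) (seq (im w) n)
      (seq (re v) n) (seq (im v) n))

  *ℂ-identityˡ : ∀ z → 1ℂ *ℂ z ≈ℂ z
  *ℂ-identityˡ z = pointwiseℂ
    (λ n → solve 2 (λ a b → con 1ℚ :* a :- con 0ℚ :* b := a) refl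
      (seq (re z) n) (seq (im z) n))
    (λ n → solve 2 (λ a b → con 1ℚ :* b :+ con 0ℚ :* a := b) refl
      (seq (re z) n) (seq (im z) n))

  *ℂ-distribˡ : ∀ z w v → z *ℂ (w +ℂ v) ≈ℂ (z *ℂ w) +ℂ (z *ℂ v)
  *ℂ-distribˡ z w v = pointwiseℂ
    (λ n → solve 6 (λ a b c d e f →
        a :* (c :+ e) :- b :* (d :+ f) :=
        (a :* c :- b :* d) :+ (a :* e :- b :* f)) refl
      (seq (re z) n) (seq (im z) n) (seq (re w) n) (seq (im w) n)
      (seq (re v) n) (seq (im v) n))
    (λ n → solve 6 (λ a b c d e f →
        a :* (d :+ f) :+ b :* (c :+ e) :=
        (a :* d :+ b :* c) :+ (a :* f :+ b :* e)) refl
      (seq (re z) n) (seq (im z) n) (seq (re w) n) (seq (im w) n)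
      (seq (re v) n) (seq (im v) n))

  ≈ℂ-refl : ∀ {z} → z ≈ℂ z
  ≈ℂ-refl = mk≈ℂ ≈ℝ-refl ≈ℝ-refl

  ≈ℂ-sym : ∀ {z w} → z ≈ℂ w → w ≈ℂ z
  ≈ℂ-sym (mk≈ℂ p q) = mk≈ℂ (≈ℝ-sym p) (≈ℝ-sym q)

  ≈ℂ-trans : ∀ {z w v} → z ≈ℂ w → w ≈ℂ v → z ≈ℂ v
  ≈ℂ-trans (mk≈ℂ p q) (mk≈ℂ p′ q′) = mk≈ℂ (≈ℝ-trans p p′) (≈ℝ-trans q q′)

  +ℂ-cong : ∀ {z w u v} → z ≈ℂ w → u ≈ℂ v → z +ℂ u ≈ℂ w +ℂ v
  +ℂ-cong {a +i b} {a′ +i b′} {c +i d} {c′ +i d′} (mk≈ℂ p q) (mk≈ℂ p′ q′) = mk≈ℂ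
    (+ℝ-cong {a} {a′} {c} {c′} p p′)
    (+ℝ-cong {b} {b′} {d} {d′} q q′)

  -ℂ-cong : ∀ {z w} → z ≈ℂ w → -ℂ z ≈ℂ -ℂ w
  -ℂ-cong {a +i b} {a′ +i b′} (mk≈ℂ p q) =
    mk≈ℂ (-ℝ-cong {a} {a′} p) (-ℝ-cong {b} {b′} q)

  *ℂ-cong : ∀ {z w u v} → z ≈ℂ w → u ≈ℂ v → z *ℂ u ≈ℂ w *ℂ v
  *ℂ-cong {a +i b} {a′ +i b′} {c +i d} {c′ +i d′} (mk≈ℂ p q) (mk≈ℂ p′ q′) = mk≈ℂ
    (+ℝ-cong {a *ℝ c} {a′ *ℝ c′} { -ℝ (b *ℝ d)} { -ℝ (b′ *ℝ d′)}
        (*ℝ-cong {a} {a′} {c} {c′} p p′)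
        (-ℝ-cong {b *ℝ d} {b′ *ℝ d′} (*ℝ-cong {b} {b′} {d} {d′} q q′)))
    (+ℝ-cong {a *ℝ d} {a′ *ℝ d′} {b *ℝ c} {b′ *ℝ c′}
        (*ℝ-cong {a} {a′} {d} {d′} p q′)
        (*ℝ-cong {b} {b′} {c} {c′} q p′))

  +ℂ-comm : ∀ z w → z +ℂ w ≈ℂ w +ℂ z
  +ℂ-comm z w = pointwiseℂ
    (λ n → ℚ.+-comm (seq (re z) n) (seq (re w) n))
    (λ n → ℚ.+-comm (seq (im z) n) (seq (im w) n))

  +ℂ-identityˡ : ∀ z → 0ℂ +ℂ z ≈ℂ z
  +ℂ-identityˡ z = pointwiseℂ
    (λ n → ℚ.+-identityˡ (seq (re z) n)) (λ n → ℚ.+-identityˡ (seq (im z) n))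

  -ℂ-inverseˡ : ∀ z → (-ℂ z) +ℂ z ≈ℂ 0ℂ
  -ℂ-inverseˡ z = pointwiseℂ
    (λ n → ℚ.+-inverseˡ (seq (re z) n)) (λ n → ℚ.+-inverseˡ (seq (im z) n))

  +ℂ-assoc : ∀ z w v → (z +ℂ w) +ℂ v ≈ℂ z +ℂ (w +ℂ v)
  +ℂ-assoc z w v = pointwiseℂ {(z +ℂ w) +ℂ v} {z +ℂ (w +ℂ v)}
    (λ n → ℚ.+-assoc (seq (re z) n) (seq (re w) n) (seq (re v) n))
    (λ n → ℚ.+-assoc (seq (im z) n) (seq (im w) n) (seq (im v) n))

  +ℂ-identityʳ : ∀ z → z +ℂ 0ℂ ≈ℂ z
  +ℂ-identityʳ z =
    ≈ℂ-trans {z +ℂ 0ℂ} {0ℂ +ℂ z} {z} (+ℂ-comm z 0ℂ) (+ℂ-identityˡ z)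

  -ℂ-inverseʳ : ∀ z → z +ℂ (-ℂ z) ≈ℂ 0ℂ
  -ℂ-inverseʳ z =
    ≈ℂ-trans {z +ℂ (-ℂ z)} {(-ℂ z) +ℂ z} {0ℂ} (+ℂ-comm z (-ℂ z)) (-ℂ-inverseˡ z)

  *ℂ-identityʳ : ∀ z → z *ℂ 1ℂ ≈ℂ z
  *ℂ-identityʳ z =
    ≈ℂ-trans {z *ℂ 1ℂ} {1ℂ *ℂ z} {z} (*ℂ-comm z 1ℂ) (*ℂ-identityˡ z)

  *ℂ-distribʳ : ∀ z w v → (w +ℂ v) *ℂ z ≈ℂ (w *ℂ z) +ℂ (v *ℂ z)
  *ℂ-distribʳ z w v =
    ≈ℂ-trans {(w +ℂ v) *ℂ z} {z *ℂ (w +ℂ v)} {(w *ℂ z) +ℂ (v *ℂ z)}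
      (*ℂ-comm (w +ℂ v) z)
      (≈ℂ-trans {z *ℂ (w +ℂ v)} {(z *ℂ w) +ℂ (z *ℂ v)} {(w *ℂ z) +ℂ (v *ℂ z)}
        (*ℂ-distribˡ z w v)
        (+ℂ-cong {z *ℂ w} {w *ℂ z} {z *ℂ v} {v *ℂ z} (*ℂ-comm z w) (*ℂ-comm z v)))

ℂ-isCommutativeRing : IsCommutativeRing _≈ℂ_ _+ℂ_ _*ℂ_ -ℂ_ 0ℂ 1ℂ
ℂ-isCommutativeRing = record
  { isRing = record
    { +-isAbelianGroup = record
      { isGroup = record
        { isMonoid = record
          { isSemigroup = record
            { isMagma = record
              { isEquivalence = record
                { refl = ≈ℂ-refl ; sym = ≈ℂ-sym ; trans = ≈ℂ-trans }
              ; ∙-cong = +ℂ-cong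
              }
            ; assoc = +ℂ-assoc
            }
          ; identity = +ℂ-identityˡ , +ℂ-identityʳ
          }
        ; inverse = -ℂ-inverseˡ , -ℂ-inverseʳ
        ; ⁻¹-cong = -ℂ-cong
        }
      ; comm = +ℂ-comm
      }
    ; *-cong = *ℂ-cong
    ; *-assoc = *ℂ-assoc
    ; *-identity = *ℂ-identityˡ , *ℂ-identityʳ
    ; distrib = *ℂ-distribˡ , *ℂ-distribʳ
    }
  ; *-comm = *ℂ-comm
  }

ℂ-commutativeRing : CommutativeRing 0ℓ 0ℓ
ℂ-commutativeRing = record { isCommutativeRing = ℂ-isCommutativeRing }

module Matrices {c ℓ : Level} (K : CommutativeRing c ℓ) where

  open CommutativeRing K
    using (Carrier; _≈_; _*_; _-_; -_; 0#; 1#; semiring)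
  open import Algebra.Definitions.RawSemiring
    (Semiring.rawSemiring semiring) using (sum; _^_)

  Matrix : ℕ → Set c
  Matrix n = Fin n → Fin n → Carrier

  infix  4 _≋_
  infixl 7 _⊗_ _•_
  infixl 6 _⊖_

  _≋_ : ∀ {n} → Matrix n → Matrix n → Set ℓ
  A ≋ B = ∀ i j → A i j ≈ B i j

  O : ∀ {n} → Matrix n
  O _ _ = 0#

  I : ∀ {n} → Matrix n
  I i j with i Fin.≟ j
  ... | yes _ = 1#
  ... | no  _ = 0#

  _⊗_ : ∀ {n} → Matrix n → Matrix n → Matrix n
  (A ⊗ B) i k = sum (λ j → A i j * B j k)

  _⊖_ : ∀ {n} → Matrix n → Matrix n → Matrix n
  (A ⊖ B) i j = A i j - B i j

  _•_ : ∀ {n} → Carrier → Matrix n → Matrix n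
  (x • A) i j = x * A i j

  IsInverse : ∀ {n} → Matrix n → Matrix n → Set ℓ
  IsInverse A B = A ⊗ B ≋ I × B ⊗ A ≋ I

  Invertible : ∀ {n} → Matrix n → Set (c ⊔ ℓ)
  Invertible A = ∃ λ B → IsInverse A B

  inverse : ∀ {n} {A : Matrix n} → Invertible A → Matrix n
  inverse = proj₁

  -- Row and column index combine i p of an (m l) × (m l) matrix lies in
  -- block i, at offset p inside that block.
  fromBlocks : ∀ {m l} → (Fin m → Fin m → Matrix l) → Matrix (m ℕ.* l)
  fromBlocks {m} {l} B x y =
    B (quotient l x) (quotient l y) (remainder {m} l x) (remainder {m} l y)

  block : ∀ {m l} → Matrix (m ℕ.* l) → Fin m → Fin m → Matrix l
  block A i j p q = A (combine i p) (combine j q)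

  -- A family a : Vector (Matrix l) m holds a₁ , … , aₘ at positions
  -- 0 , … , m - 1.  The clause for 1 is the recursion with 𝔭₋₁ = O.
  𝔭 : ∀ {l} m → Vector (Matrix l) m → Matrix l
  𝔭 zero          a = I
  𝔭 (suc zero)    a = (last a ⊗ 𝔭 zero (init a)) ⊖ O
  𝔭 (suc (suc m)) a = (last a ⊗ 𝔭 (suc m) (init a)) ⊖ 𝔭 m (init (init a))

  -- opposite reverses the order, so that aₘ is the top left block.
  𝔔-block : ∀ {l m} → Vector (Matrix l) m → Fin m → Fin m → Matrix l
  𝔔-block a i j with i Fin.≟ j | suc (toℕ i) ℕ.≟ toℕ j | suc (toℕ j) ℕ.≟ toℕ i
  ... | yes _ | _     | _     = a (opposite i)
  ... | no  _ | yes _ | _     = I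
  ... | no  _ | no  _ | yes _ = I
  ... | no  _ | no  _ | no  _ = O

  𝔔 : ∀ {l m} → Vector (Matrix l) m → Matrix (m ℕ.* l)
  𝔔 a = fromBlocks (𝔔-block a)

  -- 𝔓 for m = suc n blocks, given ℜ = 𝔔⁻¹ and the invertibility of its bottom
  -- left block.
  𝔓 : ∀ {l} n (ℜ : Matrix (suc n ℕ.* l)) →
      Invertible (block {suc n} ℜ (fromℕ n) zero) → Matrix l
  𝔓 n ℜ inv = ((- 1#) ^ n) • inverse inv

open Matrices ℂ-commutativeRing public

-- Let n = m - 1 and X = ℜₘ₁, and let v be the block column with entries
-- (-1)ⁿ⁻ⁱ 𝔭ₙ₋ᵢ for i = 0 , … , n.  By the recursion for 𝔭, the product 𝔔 v has
-- (-1)ⁿ 𝔭ₘ as its top block and zeros below, and its last n equations determine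
-- a block column from its last entry.  Hence the last block of ℜ (𝔔 v) = v reads
-- X ((-1)ⁿ 𝔭ₘ) = I.  Conversely, the first column of ℜ equals v X, so the top
-- block of 𝔔 (v X) = e₁ reads ((-1)ⁿ 𝔭ₘ) X = I.

module Submission where

open import Algebra.Bundles using (CommutativeRing; Ring; Semiring)
import Algebra.Construct.Pointwise as Pointwise
import Algebra.Properties.CommutativeSemigroup as CommutativeSemigroupProperties
import Algebra.Properties.Ring as RingProperties
import Algebra.Properties.Semiring.Sum as SemiringSum
open import Algebra.Definitions.RawSemiring using (_^_)
open import Data.Fin.Base using (Fin; zero; suc; toℕ; fromℕ; combine; _↑ˡ_; _↑ʳ_)
open import Data.Fin.Properties
  using (_≟_; 0≢1+n; suc-injective; combine-injectiveˡ; combine-injectiveʳ; remQuot-combine)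
open import Data.Nat.Base using (ℕ; zero; suc; _+_; _*_)
import Data.Nat.Properties as ℕ
open import Data.Product.Base using (Σ; _,_; proj₁; proj₂)
open import Data.Vec.Functional using (Vector; init; last)
open import Function.Base using (_∘_)
open import Level using (Level)
open import Relation.Binary.PropositionalEquality as ≡ using (_≡_; _≢_)
import Relation.Binary.Reasoning.Setoid as SetoidReasoning
open import Relation.Nullary using (yes; no; contradiction)
open import Defs using (module Matrices; ℂ-commutativeRing)

-- Finite sums over a possibly noncommutative ring.

module FiniteSums {c ℓ : Level} (R : Ring c ℓ) where

  open Ring R hiding (zero) renaming (_+_ to _⊞_; _*_ to _⊡_)
  open SemiringSum semiring
  open SetoidReasoning setoid

  sum-zero : ∀ {n} {f : Vector Carrier n} → (∀ i → f i ≈ 0#) → sum f ≈ 0#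
  sum-zero {n} f≈0 = trans (sum-cong-≋ f≈0) (sum-replicate-zero n)

  sum-single : ∀ {n} (i : Fin n) {f : Vector Carrier n} →
               (∀ j → i ≢ j → f j ≈ 0#) → sum f ≈ f i
  sum-single zero    f≈0 =
    trans (+-congˡ (sum-zero λ j → f≈0 (suc j) 0≢1+n)) (+-identityʳ _)
  sum-single (suc i) f≈0 =
    trans (+-cong (f≈0 zero λ ()) (sum-single i λ j i≢j → f≈0 (suc j) (i≢j ∘ suc-injective)))
          (+-identityˡ _)

  sum-++ : ∀ m n (f : Vector Carrier (m + n)) →
           sum f ≈ ∑[ i < m ] f (i ↑ˡ n) ⊞ ∑[ j < n ] f (m ↑ʳ j)
  sum-++ zero    n f = sym (+-identityˡ _)
  sum-++ (suc m) n f = trans (+-congˡ (sum-++ m n (f ∘ suc))) (sym (+-assoc _ _ _))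

  sum-combine : ∀ m n (f : Vector Carrier (m * n)) →
                sum f ≈ ∑[ i < m ] ∑[ j < n ] f (combine i j)
  sum-combine zero    n f = refl
  sum-combine (suc m) n f =
    trans (sum-++ n (m * n) f) (+-congˡ (sum-combine m n (f ∘ (n ↑ʳ_))))

  -- Serves twice: with scalar entries it is associativity of `_⊗_`, with blocks as entries it
  -- reassociates a block row, a block matrix and a block column.
  sum-*-assoc : ∀ {m n} (r : Vector Carrier m) (q : Fin m → Vector Carrier n)
                (x : Vector Carrier n) →
                ∑[ j < n ] (∑[ k < m ] (r k ⊡ q k j) ⊡ x j) ≈
                ∑[ k < m ] (r k ⊡ ∑[ j < n ] (q k j ⊡ x j))
  sum-*-assoc {m} {n} r q x = begin
    ∑[ j < n ] (∑[ k < m ] (r k ⊡ q k j) ⊡ x j)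
      ≈⟨ sum-cong-≋ (λ j → *-distribʳ-sum (x j) (λ k → r k ⊡ q k j)) ⟩
    ∑[ j < n ] ∑[ k < m ] ((r k ⊡ q k j) ⊡ x j)
      ≈⟨ ∑-comm (λ j k → (r k ⊡ q k j) ⊡ x j) ⟩
    ∑[ k < m ] ∑[ j < n ] ((r k ⊡ q k j) ⊡ x j)
      ≈⟨ sum-cong-≋ (λ k → sum-cong-≋ λ j → *-assoc (r k) (q k j) (x j)) ⟩
    ∑[ k < m ] ∑[ j < n ] (r k ⊡ (q k j ⊡ x j))
      ≈⟨ sum-cong-≋ (λ k → *-distribˡ-sum (r k) (λ j → q k j ⊡ x j)) ⟨
    ∑[ k < m ] (r k ⊡ ∑[ j < n ] (q k j ⊡ x j)) ∎

-- The ring of square matrices.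

module MatrixRing {c ℓ : Level} (K : CommutativeRing c ℓ) where

  open CommutativeRing K hiding (zero) renaming (_+_ to _⊞_; _*_ to _⊡_)
  open Matrices K
  open SemiringSum semiring
  open FiniteSums ring
  open CommutativeSemigroupProperties *-commutativeSemigroup using (x∙yz≈y∙xz)

  I-diagonal : ∀ {n} (i : Fin n) → I i i ≈ 1#
  I-diagonal i with i ≟ i
  ... | yes _   = refl
  ... | no  i≢i = contradiction ≡.refl i≢i

  I-off-diagonal : ∀ {n} {i j : Fin n} → i ≢ j → I i j ≈ 0#
  I-off-diagonal {i = i} {j} i≢j with i ≟ j
  ... | yes i≡j = contradiction i≡j i≢j
  ... | no  _   = refl

  ⊗-identityˡ : ∀ {n} (A : Matrix n) → I ⊗ A ≋ A
  ⊗-identityˡ A i k = trans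
    (sum-single i λ j i≢j → trans (*-congʳ (I-off-diagonal i≢j)) (zeroˡ _))
    (trans (*-congʳ (I-diagonal i)) (*-identityˡ _))

  ⊗-identityʳ : ∀ {n} (A : Matrix n) → A ⊗ I ≋ A
  ⊗-identityʳ A i k = trans
    (sum-single k λ j k≢j → trans (*-congˡ (I-off-diagonal (k≢j ∘ ≡.sym))) (zeroʳ _))
    (trans (*-congˡ (I-diagonal k)) (*-identityʳ _))

  -- Packaged as a `Ring` so that sums and ring identities become available with whole blocks as
  -- elements.
  matrixRing : ℕ → Ring c ℓ
  matrixRing n = record
    { Carrier = Matrix n
    ; _≈_     = _≋_
    ; _+_     = λ A B i j → A i j ⊞ B i j
    ; _*_     = _⊗_
    ; -_      = λ A i j → - A i j
    ; 0#      = O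
    ; 1#      = I
    ; isRing  = record
      { +-isAbelianGroup = Pointwise.isAbelianGroup (Fin n)
          (Pointwise.isAbelianGroup (Fin n) +-isAbelianGroup)
      ; *-cong     = λ A≋B C≋D i k → sum-cong-≋ λ j → *-cong (A≋B i j) (C≋D j k)
      ; *-assoc    = λ A B C i k → sum-*-assoc (A i) B (λ j → C j k)
      ; *-identity = ⊗-identityˡ , ⊗-identityʳ
      ; distrib    =
          (λ A B C i k → trans (sum-cong-≋ λ j → distribˡ (A i j) (B j k) (C j k))
            (∑-distrib-+ (λ j → A i j ⊡ B j k) (λ j → A i j ⊡ C j k))) ,
          (λ A B C i k → trans (sum-cong-≋ λ j → distribʳ (A j k) (B i j) (C i j))
            (∑-distrib-+ (λ j → B i j ⊡ A j k) (λ j → C i j ⊡ A j k)))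
      }
    }

  -- Block decomposition of products and of the identity.

  module _ {l : ℕ} where

    private module S = SemiringSum (Ring.semiring (matrixRing l))

    sum-pointwise : ∀ {n} (f : Vector (Matrix l) n) i j →
                    S.sum f i j ≈ ∑[ k < n ] f k i j
    sum-pointwise {zero}  f i j = refl
    sum-pointwise {suc n} f i j = +-congˡ (sum-pointwise (f ∘ suc) i j)

    •-cong : ∀ {x y} {A B : Matrix l} → x ≈ y → A ≋ B → x • A ≋ y • B
    •-cong x≈y A≋B i j = *-cong x≈y (A≋B i j)

    •-identity : (A : Matrix l) → 1# • A ≋ A
    •-identity A i j = *-identityˡ _

    ⊗-•-comm : ∀ x (A B : Matrix l) → A ⊗ (x • B) ≋ x • (A ⊗ B)
    ⊗-•-comm x A B i k = trans
      (sum-cong-≋ λ j → x∙yz≈y∙xz (A i j) x (B j k))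
      (sym (*-distribˡ-sum x (λ j → A i j ⊡ B j k)))

    -- The inner summation index splits into a block number and an offset: the offset sum is a
    -- product of blocks, the outer sum runs in the matrix ring.
    block-⊗ : ∀ {m} (A B : Matrix (m * l)) i k →
              block {m} (A ⊗ B) i k ≋ S.∑[ j < m ] (block {m} A i j ⊗ block {m} B j k)
    block-⊗ {m} A B i k p q = trans
      (sum-combine m l _) (sym (sum-pointwise {m} _ p q))

    block-fromBlocks : ∀ {m} (B : Fin m → Fin m → Matrix l) i j →
                       block {m} (fromBlocks {m} B) i j ≋ B i j
    block-fromBlocks {m} B i j p q = reflexive
      (≡.cong₂ (λ x y → B (proj₁ x) (proj₁ y) (proj₂ x) (proj₂ y))
        (remQuot-combine {m} {l} i p) (remQuot-combine {m} {l} j q))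

    block-I-diagonal : ∀ {m} (i : Fin m) → block {m} {l} I i i ≋ I
    block-I-diagonal {m} i p q with p ≟ q
    ... | yes ≡.refl = I-diagonal (combine i p)
    ... | no  p≢q    = I-off-diagonal (p≢q ∘ combine-injectiveʳ i p i q)

    block-I-off-diagonal : ∀ {m} {i j : Fin m} → i ≢ j → block {m} {l} I i j ≋ O
    block-I-off-diagonal {i = i} {j} i≢j p q =
      I-off-diagonal (i≢j ∘ combine-injectiveˡ i p j q)

-- Signed polynomials and their recursion.

module Continuants {c ℓ : Level} (K : CommutativeRing c ℓ) (l : ℕ) where

  private
    module K  = CommutativeRing K
    module KP = RingProperties K.ring
  open Matrices K
  open MatrixRing K
  open Ring (matrixRing l) hiding (zero) renaming (_+_ to _⊞_; _*_ to _⊡_)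
  open RingProperties (matrixRing l)
  open SemiringSum semiring
  open FiniteSums (matrixRing l)
  open SetoidReasoning setoid

  infixr 7 _⋆_

  _⋆_ : ∀ {m} → (Fin m → Fin m → Matrix l) → Vector (Matrix l) m → Vector (Matrix l) m
  _⋆_ {m} B x i = ∑[ j < m ] (B i j ⊡ x j)

  -- Agrees by definition with the power of `- 1#` in `𝔓`.
  sign : ℕ → K.Carrier
  sign m = _^_ (Semiring.rawSemiring K.semiring) (K.- K.1#) m

  sign-suc : ∀ m (A : Matrix l) → sign (suc m) • A ≈ - (sign m • A)
  sign-suc m A i j = K.trans (K.*-assoc _ _ _) (KP.-1*x≈-x _)

  sign-•-involutive : ∀ m (A : Matrix l) → sign m • (sign m • A) ≈ A
  sign-•-involutive zero    A = trans (•-identity _) (•-identity A)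
  sign-•-involutive (suc m) A = begin
    sign (suc m) • (sign (suc m) • A)  ≈⟨ sign-suc m _ ⟩
    - (sign m • (sign (suc m) • A))    ≈⟨ -‿cong (•-cong K.refl (sign-suc m A)) ⟩
    - (sign m • (- (sign m • A)))      ≈⟨ -‿cong (λ i j → KP.-‿distribʳ-* _ _) ⟨
    - - (sign m • (sign m • A))        ≈⟨ -‿involutive _ ⟩
    sign m • (sign m • A)              ≈⟨ sign-•-involutive m A ⟩
    A                                  ∎

  -- The alternating sign turns the difference in the recursion of `𝔭` into a sum, matching the
  -- off-diagonal blocks `I` of `𝔔`.
  𝔴 : ∀ m → Vector (Matrix l) m → Matrix l
  𝔴 m a = sign m • 𝔭 m a

  -𝔴 : ∀ m a → - 𝔴 (suc m) a ≈ sign m • 𝔭 (suc m) a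
  -𝔴 m a = trans (-‿cong (sign-suc m _)) (-‿involutive _)

  𝔴-rec₁ : (a : Vector (Matrix l) 1) → last a ⊡ 𝔴 0 (init a) ≈ - 𝔴 1 a
  𝔴-rec₁ a = begin
    last a ⊡ 𝔴 0 (init a)      ≈⟨ ⊗-•-comm _ (last a) I ⟩
    -- The clause for `𝔭 1` subtracts `O`, which is inserted here.
    sign 0 • (last a ⊡ I)      ≈⟨ •-cong K.refl (+-identityʳ _) ⟨
    sign 0 • (last a ⊡ I ⊞ O)  ≈⟨ •-cong K.refl (+-congˡ -0#≈0#) ⟨
    sign 0 • 𝔭 1 a             ≈⟨ -𝔴 0 a ⟨
    - 𝔴 1 a                    ∎

  𝔴-rec : ∀ m (a : Vector (Matrix l) (suc (suc m))) →
          last a ⊡ 𝔴 (suc m) (init a) ⊞ 𝔴 m (init (init a)) ≈ - 𝔴 (suc (suc m)) a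
  𝔴-rec m a = begin
    last a ⊡ 𝔴 (suc m) (init a) ⊞ 𝔴 m (init (init a))
      -- A double negation on the second term lets both terms carry the factor `sign (suc m)`.
      ≈⟨ +-cong (⊗-•-comm _ (last a) (𝔭 (suc m) (init a))) (sym (-‿involutive _)) ⟩
    sign (suc m) • (last a ⊡ 𝔭 (suc m) (init a)) ⊞ - - 𝔴 m (init (init a))
      ≈⟨ +-congˡ (-‿cong (sign-suc m _)) ⟨
    sign (suc m) • (last a ⊡ 𝔭 (suc m) (init a)) - sign (suc m) • 𝔭 m (init (init a))
      ≈⟨ (λ i j → KP.x[y-z]≈xy-xz _ _ _) ⟨
    sign (suc m) • 𝔭 (suc (suc m)) a
      ≈⟨ -𝔴 (suc m) a ⟨
    - 𝔴 (suc (suc m)) a ∎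

  -- The diagonal runs in reverse order, so deleting the first block row and column removes exactly
  -- `last a`.
  𝔔-block-suc : ∀ {m} (a : Vector (Matrix l) (suc m)) i j →
                𝔔-block a (suc i) (suc j) ≡ 𝔔-block (init a) i j
  𝔔-block-suc a i j
    -- One test settles the diagonal for both index pairs; the tests on `ℕ` are made for each pair,
    -- and disagreeing outcomes are refuted.
    with i ≟ j
       | suc (toℕ i) ℕ.≟ toℕ j | suc (suc (toℕ i)) ℕ.≟ suc (toℕ j)
       | suc (toℕ j) ℕ.≟ toℕ i | suc (suc (toℕ j)) ℕ.≟ suc (toℕ i)
  ... | yes _ | _     | _     | _     | _     = ≡.refl
  ... | no  _ | yes p | no ¬p | _     | _     = contradiction (≡.cong suc p) ¬p
  ... | no  _ | no ¬p | yes p | _     | _     = contradiction (ℕ.suc-injective p) ¬p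
  ... | no  _ | yes _ | yes _ | _     | _     = ≡.refl
  ... | no  _ | no  _ | no  _ | yes p | no ¬p = contradiction (≡.cong suc p) ¬p
  ... | no  _ | no  _ | no  _ | no ¬p | yes p = contradiction (ℕ.suc-injective p) ¬p
  ... | no  _ | no  _ | no  _ | yes _ | yes _ = ≡.refl
  ... | no  _ | no  _ | no  _ | no  _ | no  _ = ≡.refl

  -- Block rows of `𝔔` acting on a block column.

  ⋆-suc : ∀ {m} (a : Vector (Matrix l) (suc m)) x i →
          (𝔔-block a ⋆ x) (suc i) ≈
          𝔔-block a (suc i) zero ⊡ x zero ⊞ (𝔔-block (init a) ⋆ (x ∘ suc)) i
  ⋆-suc a x i = +-congˡ (sum-cong-≋ λ j → *-congʳ (reflexive (𝔔-block-suc a i j)))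

  ⋆-row₀-single : (a : Vector (Matrix l) 1) → ∀ x → (𝔔-block a ⋆ x) zero ≈ last a ⊡ x zero
  ⋆-row₀-single a x = +-identityʳ _

  ⋆-row₀ : ∀ {m} (a : Vector (Matrix l) (suc (suc m))) x →
           (𝔔-block a ⋆ x) zero ≈ last a ⊡ x zero ⊞ x (suc zero)
  ⋆-row₀ a x = +-congˡ (begin
    I ⊡ x (suc zero) ⊞ sum (λ j → O ⊡ x (suc (suc j)))
      ≈⟨ +-cong (*-identityˡ _) (sum-zero λ j → zeroˡ (x (suc (suc j)))) ⟩
    x (suc zero) ⊞ O
      ≈⟨ +-identityʳ _ ⟩
    x (suc zero) ∎)

  -- Below the diagonal the first block column is `I` followed by zeros, so only this row, and none
  -- further down, sees `x zero`.
  ⋆-row₁ : ∀ {m} (a : Vector (Matrix l) (suc (suc m))) x →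
           (𝔔-block a ⋆ x) (suc zero) ≈ x zero ⊞ (𝔔-block (init a) ⋆ (x ∘ suc)) zero
  ⋆-row₁ a x = trans (⋆-suc a x zero) (+-congʳ (*-identityˡ _))

  ⋆-row₂ : ∀ {m} (a : Vector (Matrix l) (suc (suc m))) x i →
           (𝔔-block a ⋆ x) (suc (suc i)) ≈ (𝔔-block (init a) ⋆ (x ∘ suc)) (suc i)
  ⋆-row₂ a x i = trans (⋆-suc a x (suc i)) (trans (+-congʳ (zeroˡ _)) (+-identityˡ _))

  -- Recursion through `init a` makes the tail of the column the corresponding column for the
  -- smaller matrix of `𝔔-block-suc`.
  𝔳 : ∀ {m} → Vector (Matrix l) m → Vector (Matrix l) m
  𝔳 a zero    = 𝔴 _ (init a)
  𝔳 a (suc i) = 𝔳 (init a) i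

  𝔳-last : ∀ n (a : Vector (Matrix l) (suc n)) → last (𝔳 a) ≈ I
  𝔳-last zero    a = •-identity I
  𝔳-last (suc n) a = 𝔳-last n (init a)

  -- Solving all block rows of `𝔔` except the top one.

  𝔔⋆𝔳-zero : ∀ n (a : Vector (Matrix l) (suc n)) → (𝔔-block a ⋆ 𝔳 a) zero ≈ - 𝔴 (suc n) a
  𝔔⋆𝔳-zero zero    a = trans (⋆-row₀-single a (𝔳 a)) (𝔴-rec₁ a)
  𝔔⋆𝔳-zero (suc n) a = trans (⋆-row₀ a (𝔳 a)) (𝔴-rec n a)

  -- Row 1 adds the top entry of `𝔳 a` to the top row for `init a`, whose value is the negative of
  -- that entry; lower rows follow by induction.
  𝔔⋆𝔳-suc : ∀ n (a : Vector (Matrix l) (suc n)) i → (𝔔-block a ⋆ 𝔳 a) (suc i) ≈ O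
  𝔔⋆𝔳-suc (suc n) a zero = begin
    (𝔔-block a ⋆ 𝔳 a) (suc zero)
      ≈⟨ ⋆-row₁ a (𝔳 a) ⟩
    𝔴 (suc n) (init a) ⊞ (𝔔-block (init a) ⋆ 𝔳 (init a)) zero
      ≈⟨ +-congˡ (𝔔⋆𝔳-zero n (init a)) ⟩
    𝔴 (suc n) (init a) ⊞ - 𝔴 (suc n) (init a)
      ≈⟨ -‿inverseʳ _ ⟩
    O ∎
  𝔔⋆𝔳-suc (suc n) a (suc i) = trans (⋆-row₂ a (𝔳 a) i) (𝔔⋆𝔳-suc n (init a) i)

  -- Blocks do not commute in general: `𝔔` acts from the left, so solutions are rescaled from the
  -- right.
  ⋆-⊡ : ∀ {m} (B : Fin m → Fin m → Matrix l) x y i →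
        (B ⋆ (λ j → x j ⊡ y)) i ≈ (B ⋆ x) i ⊡ y
  ⋆-⊡ B x y i = trans (sum-cong-≋ λ j → sym (*-assoc (B i j) (x j) y))
                      (sym (*-distribʳ-sum y (λ j → B i j ⊡ x j)))

  ⋆-cong : ∀ {m} (B : Fin m → Fin m → Matrix l) {x y} → (∀ j → x j ≈ y j) →
           ∀ i → (B ⋆ x) i ≈ (B ⋆ y) i
  ⋆-cong B x≈y i = sum-cong-≋ λ j → *-congˡ (x≈y j)

  𝔔⋆𝔳⊡-zero : ∀ n (a : Vector (Matrix l) (suc n)) {x y} → (∀ j → x j ≈ 𝔳 a j ⊡ y) →
              (𝔔-block a ⋆ x) zero ≈ - 𝔴 (suc n) a ⊡ y
  𝔔⋆𝔳⊡-zero n a {x} {y} x≈𝔳y = begin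
    (𝔔-block a ⋆ x) zero                  ≈⟨ ⋆-cong (𝔔-block a) x≈𝔳y zero ⟩
    (𝔔-block a ⋆ (λ j → 𝔳 a j ⊡ y)) zero  ≈⟨ ⋆-⊡ (𝔔-block a) (𝔳 a) y zero ⟩
    (𝔔-block a ⋆ 𝔳 a) zero ⊡ y            ≈⟨ *-congʳ (𝔔⋆𝔳-zero n a) ⟩
    - 𝔴 (suc n) a ⊡ y                     ∎

  -- Back substitution from the bottom: induction fixes the tail, and row 1 then gives `x zero`,
  -- whose coefficient there is `I`.
  𝔳-unique : ∀ n (a : Vector (Matrix l) (suc n)) x →
             (∀ i → (𝔔-block a ⋆ x) (suc i) ≈ O) → ∀ i → x i ≈ 𝔳 a i ⊡ last x
  𝔳-unique zero    a x 𝔔x≈0 zero = sym (trans (*-congʳ (𝔳-last 0 a)) (*-identityˡ _))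
  𝔳-unique (suc n) a x 𝔔x≈0 = λ { zero → x₀≈ ; (suc i) → x₁≈ i }
    where
    x₁≈ : ∀ i → x (suc i) ≈ 𝔳 (init a) i ⊡ last x
    x₁≈ = 𝔳-unique n (init a) (x ∘ suc) λ i → trans (sym (⋆-row₂ a x i)) (𝔔x≈0 (suc i))
    x₀≈ : x zero ≈ 𝔴 (suc n) (init a) ⊡ last x
    x₀≈ = begin
      x zero
        ≈⟨ +-inverseˡ-unique _ _ (trans (sym (⋆-row₁ a x)) (𝔔x≈0 zero)) ⟩
      - (𝔔-block (init a) ⋆ (x ∘ suc)) zero
        ≈⟨ -‿cong (𝔔⋆𝔳⊡-zero n (init a) x₁≈) ⟩
      - (- 𝔴 (suc n) (init a) ⊡ last x)
        ≈⟨ -‿distribˡ-* _ _ ⟩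
      - - 𝔴 (suc n) (init a) ⊡ last x
        ≈⟨ *-congʳ {last x} (-‿involutive _) ⟩
      𝔴 (suc n) (init a) ⊡ last x ∎

  -- The bottom left block of the inverse.

  module _ (n : ℕ) (a : Vector (Matrix l) (suc n)) (ℜ : Matrix (suc n * l)) where

    private
      R : Fin (suc n) → Fin (suc n) → Matrix l
      R = block {suc n} ℜ

      X : Matrix l
      X = R (fromℕ n) zero

    -- The lower rows annihilate the first block column of `ℜ`, so it equals `𝔳 a` times its last
    -- entry `X`; the top row then yields the equation.
    corner-inverseˡ : 𝔔 a ⊗ ℜ ≋ I → - 𝔴 (suc n) a ⊡ X ≈ I
    corner-inverseˡ 𝔔ℜ≋I = trans (sym (𝔔⋆𝔳⊡-zero n a (𝔳-unique n a x 𝔔x≈0))) 𝔔x≈I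
      where
      x : Vector (Matrix l) (suc n)
      x i = R i zero
      𝔔x : ∀ i → (𝔔-block a ⋆ x) i ≈ block {suc n} I i zero
      𝔔x i = begin
        (𝔔-block a ⋆ x) i
          ≈⟨ sum-cong-≋ (λ j → *-congʳ {R j zero} (block-fromBlocks {m = suc n} (𝔔-block a) i j)) ⟨
        ∑[ j < suc n ] (block {suc n} (𝔔 a) i j ⊡ R j zero)
          ≈⟨ block-⊗ {m = suc n} (𝔔 a) ℜ i zero ⟨
        block {suc n} (𝔔 a ⊗ ℜ) i zero
          ≈⟨ (λ p q → 𝔔ℜ≋I (combine i p) (combine {suc n} zero q)) ⟩
        block {suc n} I i zero ∎
      𝔔x≈I : (𝔔-block a ⋆ x) zero ≈ I
      𝔔x≈I = trans (𝔔x zero) (block-I-diagonal {m = suc n} zero)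
      𝔔x≈0 : ∀ i → (𝔔-block a ⋆ x) (suc i) ≈ O
      𝔔x≈0 i = trans (𝔔x (suc i)) (block-I-off-diagonal {m = suc n} {suc i} {zero} λ ())

    -- Evaluates the last block row of `ℜ` times `𝔔 a` times `𝔳 a` with both bracketings.
    corner-inverseʳ : ℜ ⊗ 𝔔 a ≋ I → X ⊡ - 𝔴 (suc n) a ≈ I
    corner-inverseʳ ℜ𝔔≋I = begin
      X ⊡ - 𝔴 (suc n) a
        ≈⟨ *-congˡ (𝔔⋆𝔳-zero n a) ⟨
      X ⊡ y zero
        ≈⟨ +-identityʳ _ ⟨
      X ⊡ y zero ⊞ O
        -- Only the term at `zero` survives, because `y` vanishes below its top entry.
        ≈⟨ +-congˡ (sum-zero λ k → trans (*-congˡ (𝔔⋆𝔳-suc n a k)) (zeroʳ _)) ⟨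
      ∑[ k < suc n ] (R (fromℕ n) k ⊡ y k)
        ≈⟨ sum-*-assoc (R (fromℕ n)) (𝔔-block a) (𝔳 a) ⟨
      ∑[ j < suc n ] (∑[ k < suc n ] (R (fromℕ n) k ⊡ 𝔔-block a k j) ⊡ 𝔳 a j)
        ≈⟨ sum-cong-≋ (λ j → *-congʳ {𝔳 a j} (ℜ𝔔 j)) ⟩
      ∑[ j < suc n ] (block {suc n} I (fromℕ n) j ⊡ 𝔳 a j)
        ≈⟨ sum-single (fromℕ n) (λ j n≢j →
             trans (*-congʳ {𝔳 a j} (block-I-off-diagonal {m = suc n} n≢j)) (zeroˡ (𝔳 a j))) ⟩
      block {suc n} I (fromℕ n) (fromℕ n) ⊡ last (𝔳 a)
        ≈⟨ *-cong (block-I-diagonal {m = suc n} (fromℕ n)) (𝔳-last n a) ⟩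
      I ⊡ I
        ≈⟨ *-identityˡ _ ⟩
      I ∎
      where
      y : Vector (Matrix l) (suc n)
      y = 𝔔-block a ⋆ 𝔳 a
      ℜ𝔔 : ∀ j → ∑[ k < suc n ] (R (fromℕ n) k ⊡ 𝔔-block a k j) ≈ block {suc n} I (fromℕ n) j
      ℜ𝔔 j = begin
        ∑[ k < suc n ] (R (fromℕ n) k ⊡ 𝔔-block a k j)
          ≈⟨ sum-cong-≋ (λ k → *-congˡ {R (fromℕ n) k} (block-fromBlocks {m = suc n} (𝔔-block a) k j)) ⟨
        ∑[ k < suc n ] (R (fromℕ n) k ⊡ block {suc n} (𝔔 a) k j)
          ≈⟨ block-⊗ {m = suc n} ℜ (𝔔 a) (fromℕ n) j ⟨
        block {suc n} (ℜ ⊗ 𝔔 a) (fromℕ n) j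
          ≈⟨ (λ p q → ℜ𝔔≋I (combine (fromℕ n) p) (combine j q)) ⟩
        block {suc n} I (fromℕ n) j ∎

    corner-isInverse : IsInverse (𝔔 a) ℜ → IsInverse X (sign n • 𝔭 (suc n) a)
    corner-isInverse (𝔔ℜ≋I , ℜ𝔔≋I) =
      trans (*-congˡ (sym (-𝔴 n a))) (corner-inverseʳ ℜ𝔔≋I) ,
      trans (*-congʳ (sym (-𝔴 n a))) (corner-inverseˡ 𝔔ℜ≋I)

open import Defs

proposition46 : ∀ (l n : ℕ) (a : Vector (Matrix l) (suc n)) →
    (∀ i → Invertible (a i)) →
    (ℜ : Matrix (suc n * l)) → IsInverse (𝔔 a) ℜ →
    Σ (Invertible (block {suc n} ℜ (fromℕ n) zero)) λ inv →
    𝔓 n ℜ inv ≋ 𝔭 (suc n) a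
proposition46 l n a _ ℜ 𝔔ℜ =
  -- The factor `sign n` in this inverse cancels against the one in `𝔓`.
  (sign n • 𝔭 (suc n) a , corner-isInverse n a ℜ 𝔔ℜ) , sign-•-involutive n (𝔭 (suc n) a)
  where open Continuants ℂ-commutativeRing l
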